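{- Let $G$ be a left-compressed $3$-graph on the vertex set $[t]$ that does not contain a clique of order $\lfloor \frac{t-2}{2}\rfloor$. Then $$\lambda(G)\le \frac{1}{6}\,\frac{(t-3)^2}{(t-2)(t-1)}<\lambda([t-1]^{(3)}).$$
   Context: A $3$-graph $G$ on vertex set $[t]=\{1,\dots,t\}$ has an edge set $E$ of $3$-element subsets of $[t]$; an edge $\{a,b,c\}$ is written $abc$. $G$ is left-compressed if whenever $j_1j_2j_3\in E$ and $i_1,i_2,i_3$ are distinct with $i_p\le j_p$ for $p=1,2,3$, then $i_1i_2i_3\in E$. A clique of order $s$ is a set of $s$ vertices all of whose $3$-subsets are edges. $[t-1]^{(3)}$ is the complete $3$-graph on $[t-1]$. For $\vec x\in\mathbb R^t$, $\lambda(G,\vec x)=\sum_{ijk\in E}x_ix_jx_k$, and the Lagrangian is $\lambda(G)=\max\{\lambda(G,\vec x):\sum_i x_i=1,\ x_i\ge0\}$.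
   Formalization: The upper bound is asserted only for points $\vec x$ of the simplex with rational coordinates, and the point witnessing the gap below $\lambda([t-1]^{(3)})$ also has rational coordinates. -}

module Defs where

open import Data.Bool using (Bool; true; false; not; _∧_)
open import Data.Nat as ℕ using (ℕ)
open import Data.Fin using (Fin; _<?_; _≟_)
import Data.Fin as F
open import Data.List using (List; []; _∷_; concatMap; foldr; map)
open import Data.List.Base using (filterᵇ)
open import Data.Fin.Base using ()
open import Data.List using () renaming (allFin to allFinL)
open import Data.Product using (_×_; _,_; Σ)
open import Data.Integer using (+_)
open import Data.Rational using (ℚ; _+_; _*_; _≤_; 0ℚ; 1ℚ; _/_)
open import Relation.Nullary using (¬_; ⌊_⌋)
open import Relation.Binary.PropositionalEquality using (_≡_)
open import Function using (_∘_)

-- A 3-graph on vertex set Fin t ([t]) is given by an edge indicator on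
-- ordered triples that is invariant under permutations and false on
-- triples with a repeated vertex; {a,b,c} ∈ E  iff  edge a b c ≡ true.
Edges : ℕ → Set
Edges t = Fin t → Fin t → Fin t → Bool

record Is3Graph {t : ℕ} (E : Edges t) : Set where
  field
    swap₁₂ : ∀ a b c → E a b c ≡ E b a c
    swap₂₃ : ∀ a b c → E a b c ≡ E a c b
    nondeg : ∀ a c → E a a c ≡ false

LeftCompressed : {t : ℕ} → Edges t → Set
LeftCompressed {t} E =
  ∀ (i₁ i₂ i₃ j₁ j₂ j₃ : Fin t) → E j₁ j₂ j₃ ≡ true →
  ¬ (i₁ ≡ i₂) → ¬ (i₁ ≡ i₃) → ¬ (i₂ ≡ i₃) →
  i₁ F.≤ j₁ → i₂ F.≤ j₂ → i₃ F.≤ j₃ → E i₁ i₂ i₃ ≡ true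

HasClique : {t : ℕ} → Edges t → ℕ → Set
HasClique {t} E s =
  Σ (Fin s → Fin t) λ f →
    (∀ p q → f p ≡ f q → p ≡ q) ×
    (∀ p q r → ¬ (p ≡ q) → ¬ (p ≡ r) → ¬ (q ≡ r) → E (f p) (f q) (f r) ≡ true)

Complete : (n : ℕ) → Edges n
Complete n a b c = not ⌊ a ≟ b ⌋ ∧ not ⌊ a ≟ c ⌋ ∧ not ⌊ b ≟ c ⌋

triples : (t : ℕ) → List (Fin t × Fin t × Fin t)
triples t =
  concatMap (λ i → concatMap (λ j →
    map (λ k → (i , j , k)) (filterᵇ (λ k → ⌊ j <? k ⌋) (allFinL t)))
      (filterᵇ (λ j → ⌊ i <? j ⌋) (allFinL t)))
    (allFinL t)

sumℚ : List ℚ → ℚ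
sumℚ = foldr _+_ 0ℚ

lagPoly : {t : ℕ} → Edges t → (Fin t → ℚ) → ℚ
lagPoly {t} E x =
  sumℚ (map (λ { (i , j , k) → x i * x j * x k })
            (filterᵇ (λ { (i , j , k) → E i j k }) (triples t)))

InSimplex : {t : ℕ} → (Fin t → ℚ) → Set
InSimplex {t} x = (∀ i → 0ℚ ≤ x i) × (sumℚ (map x (allFinL t)) ≡ 1ℚ)

ℕ→ℚ : ℕ → ℚ
ℕ→ℚ n = + n / 1

-- Left compression forces every edge of G to meet a short prefix of [t]: an edge
-- i < j < k with i ≥ a := ⌊(t − 2)/2⌋ − 3 (vertices counted from 0) would dominate every
-- triple of [a + 3] and so produce the forbidden clique. Hence λ(G, x) is at most the sum
-- of x_i x_j x_k over the triples meeting a prefix of length N. If α and β are the masses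
-- of the prefix and of the rest, Newton's identities give
--   6 · (that sum) = 1 − β³ + Σ_{i<N} (2x_i³ − 3x_i²) − 3α Σ_{i≥N} x_i²,
-- and for N ≥ 4 the cubic sum lies below N times its value at the mean α/N (tangent
-- line), which leaves a polynomial inequality in N, t and β, settled by an explicit
-- certificate. When a ≤ 1 every edge contains the first vertex and λ ≤ y(1 − y)²/2 ≤ 2/27.
-- For t < 8 the forbidden clique has order at most 2, so the hypothesis fails. The
-- uniform point of [t − 1] gives the strict lower bound.

{-# OPTIONS --safe #-}
module Submission where

open import Defs
open import Data.Nat using (ℕ; _∸_; _^_) renaming (_*_ to _*ℕ_)
open import Data.Nat.DivMod using (_/_)
open import Data.Fin using (Fin)
open import Data.Product using (_×_; Σ)
open import Data.Rational using (ℚ; _*_; _≤_; _<_)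
open import Relation.Nullary using (¬_)

open import Agda.Builtin.FromNat using (Number; fromNat)
open import Data.Bool using (Bool; true; false; T; not)
open import Data.Bool.Properties using (T-≡; T-∧)
open import Data.Empty using (⊥; ⊥-elim)
open import Data.Fin as Fin using (toℕ; _<?_; _≟_)
import Data.Fin.Properties as Fin
import Data.Integer as ℤ
import Data.Integer.Properties as ℤ
open import Data.List using (List; []; _∷_; _++_; map; concatMap; take; drop; length; tabulate; filterᵇ; allFin)
open import Data.List.Properties
  using (length-tabulate; length-take; map-++; map-∘; map-cong; map-tabulate; take-map; drop-map; take++drop≡id;
         concatMap-++; filter-all; filter-none; filter-≐)
open import Data.List.Relation.Unary.All as All using (All; []; _∷_)
import Data.List.Relation.Unary.All.Properties as All
open import Data.Nat as ℕ using (zero; suc)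
import Data.Nat.Coprimality as ℕ using (Coprime; sym; 1-coprimeTo)
import Data.Nat.DivMod as ℕ using (/-monoˡ-≤; m/n*n≤m; m/n≤m)
import Data.Nat.Literals as ℕ
import Data.Nat.Properties as ℕ
open import Data.Product using (_,_; proj₁; proj₂)
open import Data.Rational as ℚ using (_+_; _-_; 0ℚ; 1ℚ; mkℚ; positive; nonNegative)
import Data.Rational.Literals as ℚ
import Data.Rational.Properties as ℚ
open import Data.Sum using (inj₁; inj₂)
open import Data.Unit using (tt)
open import Function using (_∘_; id; Equivalence; case_of_)
open import Level using (0ℓ)
open import Relation.Binary.Definitions using (tri<; tri≈; tri>)
open import Relation.Binary.PropositionalEquality
open import Relation.Nullary using (⌊_⌋; yes; no; contradiction)
open import Relation.Nullary.Decidable using (dec⇒maybe; toWitness; T?; isYes≗does)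
open import Tactic.RingSolver using (solve-∀)
open import Tactic.RingSolver.Core.AlmostCommutativeRing using (AlmostCommutativeRing; fromCommutativeRing)

instance
  ℕ-number : Number ℕ
  ℕ-number = ℕ.number

  ℚ-number : Number ℚ
  ℚ-number = ℚ.number

ℚ-ring : AlmostCommutativeRing 0ℓ 0ℓ
ℚ-ring = fromCommutativeRing ℚ.+-*-commutativeRing (λ q → dec⇒maybe (0ℚ ℚ.≟ q))

private variable
  A B C D : Set

cong₃ : ∀ (f : A → B → C → D) {a a′ b b′ c c′} → a ≡ a′ → b ≡ b′ → c ≡ c′ → f a b c ≡ f a′ b′ c′
cong₃ f refl refl refl = refl

nonNeg-gap⇒≤ : ∀ {p q} d → 0ℚ ≤ d → q ≡ p + d → p ≤ q
nonNeg-gap⇒≤ {p} d 0≤d refl = ℚ.≤-trans (ℚ.≤-reflexive (sym (ℚ.+-identityʳ p))) (ℚ.+-monoʳ-≤ p 0≤d)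

pos-gap⇒< : ∀ {p q} d → 0ℚ < d → q ≡ p + d → p < q
pos-gap⇒< {p} d 0<d refl = ℚ.≤-<-trans (ℚ.≤-reflexive (sym (ℚ.+-identityʳ p))) (ℚ.+-monoʳ-< p 0<d)

+-nonNeg : ∀ {p q} → 0ℚ ≤ p → 0ℚ ≤ q → 0ℚ ≤ p + q
+-nonNeg = ℚ.+-mono-≤

*-nonNeg : ∀ {p q} → 0ℚ ≤ p → 0ℚ ≤ q → 0ℚ ≤ p * q
*-nonNeg {p} {q} 0≤p 0≤q =
  ℚ.nonNegative⁻¹ _ {{ℚ.nonNeg*nonNeg⇒nonNeg p {{nonNegative 0≤p}} q {{nonNegative 0≤q}}}}

*-pos : ∀ {p q} → 0ℚ < p → 0ℚ < q → 0ℚ < p * q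
*-pos {p} {q} 0<p 0<q = ℚ.positive⁻¹ _ {{ℚ.pos*pos⇒pos p {{positive 0<p}} q {{positive 0<q}}}}

square-nonNeg : ∀ p → 0ℚ ≤ p * p
square-nonNeg p with ℚ.≤-total 0ℚ p
... | inj₁ 0≤p = *-nonNeg 0≤p 0≤p
... | inj₂ p≤0 = subst (0ℚ ≤_) (neg*neg p) (*-nonNeg (ℚ.neg-antimono-≤ p≤0) (ℚ.neg-antimono-≤ p≤0))
  where
  neg*neg : ∀ p → ℚ.- p * ℚ.- p ≡ p * p
  neg*neg = solve-∀ ℚ-ring

p≤q⇒0≤q-p : ∀ {p q} → p ≤ q → 0ℚ ≤ q - p
p≤q⇒0≤q-p {p} {q} p≤q = subst (_≤ q - p) (ℚ.+-inverseʳ p) (ℚ.+-monoˡ-≤ (ℚ.- p) p≤q)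

*-monoˡ-≤-nonNeg : ∀ {p q r} → 0ℚ ≤ r → p ≤ q → r * p ≤ r * q
*-monoˡ-≤-nonNeg {r = r} 0≤r = ℚ.*-monoˡ-≤-nonNeg r {{nonNegative 0≤r}}

*-monoʳ-≤-nonNeg : ∀ {p q r} → 0ℚ ≤ r → p ≤ q → p * r ≤ q * r
*-monoʳ-≤-nonNeg {r = r} 0≤r = ℚ.*-monoʳ-≤-nonNeg r {{nonNegative 0≤r}}

*-cancelˡ-≤-pos : ∀ {p q r} → 0ℚ < r → r * p ≤ r * q → p ≤ q
*-cancelˡ-≤-pos {r = r} 0<r = ℚ.*-cancelˡ-≤-pos r {{positive 0<r}}

ℕ→ℚ-suc : ∀ n → ℕ→ℚ (suc n) ≡ 1ℚ + ℕ→ℚ n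
ℕ→ℚ-suc n = begin
  ℕ→ℚ (suc n)                         ≡⟨ cong (λ i → (ℤ.+ 1 ℤ.+ i) ℚ./ 1) (sym (ℤ.*-identityʳ (ℤ.+ n))) ⟩
  (ℤ.+ 1 ℤ.+ ℤ.+ n ℤ.* ℤ.+ 1) ℚ./ 1   ≡⟨⟩
  1ℚ + mkℚ (ℤ.+ n) 0 n⊥1             ≡⟨ cong (1ℚ +_) (sym (ℚ.normalize-coprime n⊥1)) ⟩
  1ℚ + ℕ→ℚ n                          ∎
  where
  open ≡-Reasoning
  n⊥1 : ℕ.Coprime n 1
  n⊥1 = ℕ.sym (ℕ.1-coprimeTo n)

ℕ→ℚ-+ : ∀ m n → ℕ→ℚ (m ℕ.+ n) ≡ ℕ→ℚ m + ℕ→ℚ n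
ℕ→ℚ-+ zero    n = sym (ℚ.+-identityˡ (ℕ→ℚ n))
ℕ→ℚ-+ (suc m) n = begin
  ℕ→ℚ (suc (m ℕ.+ n))            ≡⟨ ℕ→ℚ-suc (m ℕ.+ n) ⟩
  1ℚ + ℕ→ℚ (m ℕ.+ n)             ≡⟨ cong (1ℚ +_) (ℕ→ℚ-+ m n) ⟩
  1ℚ + (ℕ→ℚ m + ℕ→ℚ n)           ≡⟨ ℚ.+-assoc 1ℚ (ℕ→ℚ m) (ℕ→ℚ n) ⟨
  (1ℚ + ℕ→ℚ m) + ℕ→ℚ n           ≡⟨ cong (_+ ℕ→ℚ n) (ℕ→ℚ-suc m) ⟨
  ℕ→ℚ (suc m) + ℕ→ℚ n            ∎
  where open ≡-Reasoning

ℕ→ℚ-* : ∀ m n → ℕ→ℚ (m ℕ.* n) ≡ ℕ→ℚ m * ℕ→ℚ n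
ℕ→ℚ-* zero    n = sym (ℚ.*-zeroˡ (ℕ→ℚ n))
ℕ→ℚ-* (suc m) n = begin
  ℕ→ℚ (n ℕ.+ m ℕ.* n)            ≡⟨ ℕ→ℚ-+ n (m ℕ.* n) ⟩
  ℕ→ℚ n + ℕ→ℚ (m ℕ.* n)          ≡⟨ cong (ℕ→ℚ n +_) (ℕ→ℚ-* m n) ⟩
  ℕ→ℚ n + ℕ→ℚ m * ℕ→ℚ n          ≡⟨ distrib (ℕ→ℚ m) (ℕ→ℚ n) ⟩
  (1ℚ + ℕ→ℚ m) * ℕ→ℚ n           ≡⟨ cong (_* ℕ→ℚ n) (ℕ→ℚ-suc m) ⟨
  ℕ→ℚ (suc m) * ℕ→ℚ n            ∎
  where
  open ≡-Reasoning
  distrib : ∀ a b → b + a * b ≡ (1ℚ + a) * b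
  distrib = solve-∀ ℚ-ring

ℕ→ℚ-nonNeg : ∀ n → 0ℚ ≤ ℕ→ℚ n
ℕ→ℚ-nonNeg n = ℚ.nonNegative⁻¹ _ {{ℚ.normalize-nonNeg n 1}}

ℕ→ℚ-mono-≤ : ∀ {m n} → m ℕ.≤ n → ℕ→ℚ m ≤ ℕ→ℚ n
ℕ→ℚ-mono-≤ {m} {n} m≤n = nonNeg-gap⇒≤ (ℕ→ℚ (n ∸ m)) (ℕ→ℚ-nonNeg (n ∸ m))
  (trans (cong ℕ→ℚ (sym (ℕ.m+[n∸m]≡n m≤n))) (ℕ→ℚ-+ m (n ∸ m)))

-- Sums over lists and symmetric functions

sumℚ-++ : ∀ xs ys → sumℚ (xs ++ ys) ≡ sumℚ xs + sumℚ ys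
sumℚ-++ []       ys = sym (ℚ.+-identityˡ (sumℚ ys))
sumℚ-++ (x ∷ xs) ys = trans (cong (x +_) (sumℚ-++ xs ys)) (sym (ℚ.+-assoc x (sumℚ xs) (sumℚ ys)))

sumℚ-take-drop : ∀ n xs → sumℚ (take n xs) + sumℚ (drop n xs) ≡ sumℚ xs
sumℚ-take-drop n xs = trans (sym (sumℚ-++ (take n xs) (drop n xs))) (cong sumℚ (take++drop≡id n xs))

sumℚ-map-take-drop : ∀ (g : A → ℚ) n xs →
  sumℚ (map g (take n xs)) + sumℚ (map g (drop n xs)) ≡ sumℚ (map g xs)
sumℚ-map-take-drop g n xs =
  trans (cong₂ (λ us vs → sumℚ us + sumℚ vs) (sym (take-map n xs)) (sym (drop-map n xs)))
        (sumℚ-take-drop n (map g xs))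

sumℚ-concatMap : ∀ (g : B → ℚ) (f : A → List B) xs →
  sumℚ (map g (concatMap f xs)) ≡ sumℚ (map (λ a → sumℚ (map g (f a))) xs)
sumℚ-concatMap g f []       = refl
sumℚ-concatMap g f (x ∷ xs) = begin
  sumℚ (map g (f x ++ concatMap f xs))                 ≡⟨ cong sumℚ (map-++ g (f x) (concatMap f xs)) ⟩
  sumℚ (map g (f x) ++ map g (concatMap f xs))         ≡⟨ sumℚ-++ (map g (f x)) (map g (concatMap f xs)) ⟩
  sumℚ (map g (f x)) + sumℚ (map g (concatMap f xs))   ≡⟨ cong (sumℚ (map g (f x)) +_) (sumℚ-concatMap g f xs) ⟩
  sumℚ (map g (f x)) + sumℚ (map (λ a → sumℚ (map g (f a))) xs) ∎
  where open ≡-Reasoning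

sumℚ-scale : ∀ c (g : A → ℚ) xs → sumℚ (map (λ a → c * g a) xs) ≡ c * sumℚ (map g xs)
sumℚ-scale c g []       = sym (ℚ.*-zeroʳ c)
sumℚ-scale c g (x ∷ xs) = trans (cong (c * g x +_) (sumℚ-scale c g xs)) (sym (ℚ.*-distribˡ-+ c (g x) _))

sumℚ-nonNeg : ∀ {xs} → All (0ℚ ≤_) xs → 0ℚ ≤ sumℚ xs
sumℚ-nonNeg []           = ℚ.≤-refl
sumℚ-nonNeg (0≤x ∷ 0≤xs) = +-nonNeg 0≤x (sumℚ-nonNeg 0≤xs)

All-≤-sumℚ : ∀ {xs} → All (0ℚ ≤_) xs → All (_≤ sumℚ xs) xs
All-≤-sumℚ []                    = []
All-≤-sumℚ {x ∷ xs} (0≤x ∷ 0≤xs) =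
  nonNeg-gap⇒≤ (sumℚ xs) (sumℚ-nonNeg 0≤xs) refl ∷
  All.map (λ y≤xs → ℚ.≤-trans y≤xs (nonNeg-gap⇒≤ x 0≤x (ℚ.+-comm x (sumℚ xs)))) (All-≤-sumℚ 0≤xs)

sumℚ-tabulate-const : ∀ n c → sumℚ (tabulate {n = n} (λ _ → c)) ≡ ℕ→ℚ n * c
sumℚ-tabulate-const zero    c = sym (ℚ.*-zeroˡ c)
sumℚ-tabulate-const (suc n) c = begin
  c + sumℚ (tabulate {n = n} (λ _ → c))  ≡⟨ cong (c +_) (sumℚ-tabulate-const n c) ⟩
  c + ℕ→ℚ n * c                          ≡⟨ distrib (ℕ→ℚ n) c ⟩
  (1ℚ + ℕ→ℚ n) * c                       ≡⟨ cong (_* c) (ℕ→ℚ-suc n) ⟨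
  ℕ→ℚ (suc n) * c                        ∎
  where
  open ≡-Reasoning
  distrib : ∀ a b → b + a * b ≡ (1ℚ + a) * b
  distrib = solve-∀ ℚ-ring

withTails : List A → List (A × List A)
withTails []       = []
withTails (y ∷ ys) = (y , ys) ∷ withTails ys

withTails-drop : ∀ n (xs : List A) → withTails (drop n xs) ≡ drop n (withTails xs)
withTails-drop zero    xs       = refl
withTails-drop (suc n) []       = refl
withTails-drop (suc n) (x ∷ xs) = withTails-drop n xs

e₂-term : ℚ × List ℚ → ℚ
e₂-term (y , ys) = y * sumℚ ys

e₂ : List ℚ → ℚ
e₂ xs = sumℚ (map e₂-term (withTails xs))

e₃-term : ℚ × List ℚ → ℚ
e₃-term (y , ys) = y * e₂ ys

e₃ : List ℚ → ℚ
e₃ xs = sumℚ (map e₃-term (withTails xs))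

-- the part of e₃ coming from the triples of positions i < j < k with i < n
e₃-meeting : ℕ → List ℚ → ℚ
e₃-meeting n xs = sumℚ (map e₃-term (take n (withTails xs)))

p₂ p₃ : List ℚ → ℚ
p₂ xs = sumℚ (map (λ y → y * y) xs)
p₃ xs = sumℚ (map (λ y → y * y * y) xs)

e₃-meeting-+-e₃-drop : ∀ n xs → e₃-meeting n xs + e₃ (drop n xs) ≡ e₃ xs
e₃-meeting-+-e₃-drop n xs =
  trans (cong (λ ws → e₃-meeting n xs + sumℚ (map e₃-term ws)) (withTails-drop n xs))
        (sumℚ-map-take-drop e₃-term n (withTails xs))

p₂-nonNeg : ∀ xs → 0ℚ ≤ p₂ xs
p₂-nonNeg []       = ℚ.≤-refl
p₂-nonNeg (y ∷ ys) = +-nonNeg (square-nonNeg y) (p₂-nonNeg ys)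

e₂-newton : ∀ xs → 2 * e₂ xs ≡ sumℚ xs * sumℚ xs - p₂ xs
e₂-newton []       = refl
e₂-newton (y ∷ ys) = begin
  2 * (y * s + e₂ ys)            ≡⟨ ℚ.*-distribˡ-+ 2 (y * s) (e₂ ys) ⟩
  2 * (y * s) + 2 * e₂ ys        ≡⟨ cong (2 * (y * s) +_) (e₂-newton ys) ⟩
  2 * (y * s) + (s * s - p₂ ys)  ≡⟨ expand y s (p₂ ys) ⟩
  (y + s) * (y + s) - (y * y + p₂ ys) ∎
  where
  open ≡-Reasoning
  s : ℚ
  s = sumℚ ys
  expand : ∀ y s p → 2 * (y * s) + (s * s - p) ≡ (y + s) * (y + s) - (y * y + p)
  expand = solve-∀ ℚ-ring

e₃-newton : ∀ xs → 6 * e₃ xs ≡ sumℚ xs * sumℚ xs * sumℚ xs - 3 * sumℚ xs * p₂ xs + 2 * p₃ xs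
e₃-newton []       = refl
e₃-newton (y ∷ ys) = begin
  6 * (y * e₂ ys + e₃ ys)                                   ≡⟨ regroup y (e₂ ys) (e₃ ys) ⟩
  3 * y * (2 * e₂ ys) + 6 * e₃ ys                           ≡⟨ cong₂ (λ a b → 3 * y * a + b) (e₂-newton ys) (e₃-newton ys) ⟩
  3 * y * (s * s - p) + (s * s * s - 3 * s * p + 2 * p₃ ys) ≡⟨ expand y s p (p₃ ys) ⟩
  (y + s) * (y + s) * (y + s) - 3 * (y + s) * (y * y + p) + 2 * (y * y * y + p₃ ys) ∎
  where
  open ≡-Reasoning
  s p : ℚ
  s = sumℚ ys
  p = p₂ ys
  regroup : ∀ y e f → 6 * (y * e + f) ≡ 3 * y * (2 * e) + 6 * f
  regroup = solve-∀ ℚ-ring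
  expand : ∀ y s p r → 3 * y * (s * s - p) + (s * s * s - 3 * s * p + 2 * r)
                       ≡ (y + s) * (y + s) * (y + s) - 3 * (y + s) * (y * y + p) + 2 * (y * y * y + r)
  expand = solve-∀ ℚ-ring

2*e₂≤sum² : ∀ xs → 2 * e₂ xs ≤ sumℚ xs * sumℚ xs
2*e₂≤sum² xs = nonNeg-gap⇒≤ (p₂ xs) (p₂-nonNeg xs) (trans (cancel (sumℚ xs * sumℚ xs) (p₂ xs)) (cong (_+ p₂ xs) (sym (e₂-newton xs))))
  where
  cancel : ∀ a b → a ≡ (a - b) + b
  cancel = solve-∀ ℚ-ring

e₃-meeting-newton : ∀ n xs →
  let ys = take n xs ; zs = drop n xs ; α = sumℚ ys ; β = sumℚ zs in
  6 * e₃-meeting n xs ≡ (α + β) * (α + β) * (α + β) - β * β * β + (2 * p₃ ys - 3 * (α + β) * p₂ ys) - 3 * α * p₂ zs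
e₃-meeting-newton n xs = begin
  6 * e₃-meeting n xs                           ≡⟨ difference (e₃-meeting n xs) (e₃ zs) ⟩
  6 * (e₃-meeting n xs + e₃ zs) - 6 * e₃ zs     ≡⟨ cong (λ e → 6 * e - 6 * e₃ zs) (e₃-meeting-+-e₃-drop n xs) ⟩
  6 * e₃ xs - 6 * e₃ zs                         ≡⟨ cong₂ _-_ (e₃-newton xs) (e₃-newton zs) ⟩
  newton (sumℚ xs) (p₂ xs) (p₃ xs) - newton β (p₂ zs) (p₃ zs)
    ≡⟨ cong₃ (λ s P₂ P₃ → newton s P₂ P₃ - newton β (p₂ zs) (p₃ zs))
             (sym (sumℚ-take-drop n xs)) (sym (sumℚ-map-take-drop _ n xs)) (sym (sumℚ-map-take-drop _ n xs)) ⟩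
  newton (α + β) (p₂ ys + p₂ zs) (p₃ ys + p₃ zs) - newton β (p₂ zs) (p₃ zs)
    ≡⟨ regroup α β (p₂ ys) (p₂ zs) (p₃ ys) (p₃ zs) ⟩
  (α + β) * (α + β) * (α + β) - β * β * β + (2 * p₃ ys - 3 * (α + β) * p₂ ys) - 3 * α * p₂ zs ∎
  where
  open ≡-Reasoning
  ys zs : List ℚ
  ys = take n xs
  zs = drop n xs
  α β : ℚ
  α = sumℚ ys
  β = sumℚ zs
  newton : ℚ → ℚ → ℚ → ℚ
  newton s P₂ P₃ = s * s * s - 3 * s * P₂ + 2 * P₃
  difference : ∀ a b → 6 * a ≡ 6 * (a + b) - 6 * b
  difference = solve-∀ ℚ-ring
  regroup : ∀ α β p q p′ q′ →
    (α + β) * (α + β) * (α + β) - 3 * (α + β) * (p + q) + 2 * (p′ + q′) - (β * β * β - 3 * β * q + 2 * q′)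
    ≡ (α + β) * (α + β) * (α + β) - β * β * β + (2 * p′ - 3 * (α + β) * p) - 3 * α * q
  regroup = solve-∀ ℚ-ring

-- Bounds for e₃ over the triples meeting a prefix

tangent-line : ∀ {y m} → y ≤ 1ℚ → 4 * m ≤ 1ℚ →
  2 * (y * y * y) - 3 * (y * y) ≤ (2 * (m * m * m) - 3 * (m * m)) + (6 * (m * m) - 6 * m) * (y - m)
tangent-line {y} {m} y≤1 4m≤1 = nonNeg-gap⇒≤ ((y - m) * (y - m) * (2 * (1ℚ - y) + (1ℚ - 4 * m)))
  (*-nonNeg (square-nonNeg (y - m)) (+-nonNeg (*-nonNeg (ℚ.nonNegative⁻¹ 2) (p≤q⇒0≤q-p y≤1)) (p≤q⇒0≤q-p 4m≤1)))
  (gap y m)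
  where
  gap : ∀ y m → (2 * (m * m * m) - 3 * (m * m)) + (6 * (m * m) - 6 * m) * (y - m)
              ≡ (2 * (y * y * y) - 3 * (y * y)) + (y - m) * (y - m) * (2 * (1ℚ - y) + (1ℚ - 4 * m))
  gap = solve-∀ ℚ-ring

tangent-line-sum : ∀ {m} ys → All (_≤ 1ℚ) ys → 4 * m ≤ 1ℚ →
  let n = ℕ→ℚ (length ys) in
  2 * p₃ ys - 3 * p₂ ys
    ≤ n * (2 * (m * m * m) - 3 * (m * m)) + (6 * (m * m) - 6 * m) * (sumℚ ys - n * m)
tangent-line-sum {m} []       []            _    = ℚ.≤-reflexive (empty m)
  where
  empty : ∀ m → 2 * 0ℚ - 3 * 0ℚ ≡ 0ℚ * (2 * (m * m * m) - 3 * (m * m)) + (6 * (m * m) - 6 * m) * (0ℚ - 0ℚ * m)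
  empty = solve-∀ ℚ-ring
tangent-line-sum {m} (y ∷ ys) (y≤1 ∷ ys≤1) 4m≤1 = begin
  2 * (y * y * y + p₃ ys) - 3 * (y * y + p₂ ys)
    ≡⟨ split y (p₂ ys) (p₃ ys) ⟩
  (2 * (y * y * y) - 3 * (y * y)) + (2 * p₃ ys - 3 * p₂ ys)
    ≤⟨ ℚ.+-mono-≤ (tangent-line {m = m} y≤1 4m≤1) (tangent-line-sum {m} ys ys≤1 4m≤1) ⟩
  (f + f′ * (y - m)) + (n * f + f′ * (sumℚ ys - n * m))
    ≡⟨ merge f f′ y m n (sumℚ ys) ⟩
  (1ℚ + n) * f + f′ * ((y + sumℚ ys) - (1ℚ + n) * m)
    ≡⟨ cong (λ n′ → n′ * f + f′ * ((y + sumℚ ys) - n′ * m)) (ℕ→ℚ-suc (length ys)) ⟨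
  ℕ→ℚ (suc (length ys)) * f + f′ * ((y + sumℚ ys) - ℕ→ℚ (suc (length ys)) * m) ∎
  where
  open ℚ.≤-Reasoning
  f f′ n : ℚ
  f = 2 * (m * m * m) - 3 * (m * m)
  f′ = 6 * (m * m) - 6 * m
  n = ℕ→ℚ (length ys)
  split : ∀ y p r → 2 * (y * y * y + r) - 3 * (y * y + p) ≡ (2 * (y * y * y) - 3 * (y * y)) + (2 * r - 3 * p)
  split = solve-∀ ℚ-ring
  merge : ∀ f f′ y m n s → (f + f′ * (y - m)) + (n * f + f′ * (s - n * m)) ≡ (1ℚ + n) * f + f′ * ((y + s) - (1ℚ + n) * m)
  merge = solve-∀ ℚ-ring

cubicGap : ℚ → ℚ → ℚ
cubicGap ν u = ν * ν * (u * u * u) + (1ℚ - u) * (1ℚ - u) * (3 * ν - 2 * (1ℚ - u))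

cubicGap-complement : ∀ ν u →
  ν * ν * (1ℚ - u * u * u) + (2 * ((1ℚ - u) * (1ℚ - u) * (1ℚ - u)) - 3 * ν * ((1ℚ - u) * (1ℚ - u)))
  ≡ ν * ν - cubicGap ν u
cubicGap-complement = expand
  where
  expand : ∀ ν u →
    ν * ν * (1ℚ - u * u * u) + (2 * ((1ℚ - u) * (1ℚ - u) * (1ℚ - u)) - 3 * ν * ((1ℚ - u) * (1ℚ - u)))
    ≡ ν * ν - (ν * ν * (u * u * u) + (1ℚ - u) * (1ℚ - u) * (3 * ν - 2 * (1ℚ - u)))
  expand = solve-∀ ℚ-ring

-- The tangent line is taken at the mean m = α/ν; ν ≥ 4 makes 4m ≤ 1.
power-sums-bound : ∀ {n} ys → length ys ≡ n → All (_≤ 1ℚ) ys → 4 ≤ ℕ→ℚ n → 0ℚ ≤ sumℚ ys → sumℚ ys ≤ 1ℚ →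
  let ν = ℕ→ℚ n ; α = sumℚ ys in
  ν * ν * (2 * p₃ ys - 3 * p₂ ys) ≤ 2 * (α * α * α) - 3 * ν * (α * α)
power-sums-bound ys refl ys≤1 4≤ν 0≤α α≤1 = begin
  ν * ν * (2 * p₃ ys - 3 * p₂ ys)
    ≤⟨ *-monoˡ-≤-nonNeg (square-nonNeg ν) (tangent-line-sum {m} ys ys≤1 4m≤1) ⟩
  ν * ν * (ν * f + f′ * (α - ν * m))
    ≡⟨ cong (λ a → ν * ν * (ν * f + f′ * (a - ν * m))) νm≡α ⟨
  ν * ν * (ν * f + f′ * (ν * m - ν * m))
    ≡⟨ expand ν m ⟩
  2 * ((ν * m) * (ν * m) * (ν * m)) - 3 * ν * ((ν * m) * (ν * m))
    ≡⟨ cong (λ a → 2 * (a * a * a) - 3 * ν * (a * a)) νm≡α ⟩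
  2 * (α * α * α) - 3 * ν * (α * α) ∎
  where
  open ℚ.≤-Reasoning
  ν α : ℚ
  ν = ℕ→ℚ (length ys)
  α = sumℚ ys
  0<ν : 0ℚ < ν
  0<ν = ℚ.<-≤-trans (ℚ.positive⁻¹ 4) 4≤ν
  instance
    ν≢0 : ℚ.NonZero ν
    ν≢0 = ℚ.pos⇒nonZero ν {{positive 0<ν}}
  m f f′ : ℚ
  m = α * ℚ.1/ ν
  f = 2 * (m * m * m) - 3 * (m * m)
  f′ = 6 * (m * m) - 6 * m
  νm≡α : ν * m ≡ α
  νm≡α = trans (swap ν α (ℚ.1/ ν)) (trans (cong (α *_) (ℚ.*-inverseʳ ν)) (ℚ.*-identityʳ α))
    where
    swap : ∀ a b c → a * (b * c) ≡ b * (a * c)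
    swap = solve-∀ ℚ-ring
  0≤m : 0ℚ ≤ m
  0≤m = *-nonNeg 0≤α (ℚ.<⇒≤ (ℚ.positive⁻¹ (ℚ.1/ ν) {{ℚ.1/pos⇒pos ν {{positive 0<ν}}}}))
  4m≤1 : 4 * m ≤ 1ℚ
  4m≤1 = ℚ.≤-trans (*-monoʳ-≤-nonNeg 0≤m 4≤ν) (subst (_≤ 1ℚ) (sym νm≡α) α≤1)
  expand : ∀ ν m → ν * ν * (ν * (2 * (m * m * m) - 3 * (m * m)) + (6 * (m * m) - 6 * m) * (ν * m - ν * m))
                   ≡ 2 * ((ν * m) * (ν * m) * (ν * m)) - 3 * ν * ((ν * m) * (ν * m))
  expand = solve-∀ ℚ-ring

e₃-meeting-on-simplex : ∀ n xs → sumℚ xs ≡ 1ℚ →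
  let ys = take n xs ; zs = drop n xs ; α = sumℚ ys ; β = sumℚ zs in
  6 * e₃-meeting n xs ≡ (1ℚ - β * β * β - 3 * α * p₂ zs) + (2 * p₃ ys - 3 * p₂ ys)
e₃-meeting-on-simplex n xs Σxs≡1 = trans (e₃-meeting-newton n xs)
  (trans (cong (λ s → s * s * s - β * β * β + (2 * p₃ ys - 3 * s * p₂ ys) - 3 * α * p₂ zs)
               (trans (sumℚ-take-drop n xs) Σxs≡1))
         (regroup β α (p₂ ys) (p₃ ys) (p₂ zs)))
  where
  ys zs : List ℚ
  ys = take n xs
  zs = drop n xs
  α β : ℚ
  α = sumℚ ys
  β = sumℚ zs
  regroup : ∀ b a p p′ q →
    1ℚ * 1ℚ * 1ℚ - b * b * b + (2 * p′ - 3 * 1ℚ * p) - 3 * a * q ≡ (1ℚ - b * b * b - 3 * a * q) + (2 * p′ - 3 * p)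
  regroup = solve-∀ ℚ-ring

e₃-meeting-cubicGap-bound : ∀ n xs → All (0ℚ ≤_) xs → sumℚ xs ≡ 1ℚ → n ℕ.≤ length xs → 4 ℕ.≤ n →
  let ν = ℕ→ℚ n in
  ν * ν * (6 * e₃-meeting n xs) ≤ ν * ν - cubicGap ν (sumℚ (drop n xs))
e₃-meeting-cubicGap-bound n xs 0≤xs Σxs≡1 n≤|xs| 4≤n = begin
  ν * ν * (6 * e₃-meeting n xs)
    ≡⟨ cong (ν * ν *_) (e₃-meeting-on-simplex n xs Σxs≡1) ⟩
  ν * ν * ((1ℚ - β * β * β - 3 * α * p₂ zs) + (2 * p₃ ys - 3 * p₂ ys))
    ≡⟨ ℚ.*-distribˡ-+ (ν * ν) (1ℚ - β * β * β - 3 * α * p₂ zs) (2 * p₃ ys - 3 * p₂ ys) ⟩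
  ν * ν * (1ℚ - β * β * β - 3 * α * p₂ zs) + ν * ν * (2 * p₃ ys - 3 * p₂ ys)
    ≤⟨ ℚ.+-mono-≤ (*-monoˡ-≤-nonNeg (square-nonNeg ν) drop-tail-term)
                  (power-sums-bound ys |ys|≡n ys≤1 (ℕ→ℚ-mono-≤ 4≤n) 0≤α α≤1) ⟩
  ν * ν * (1ℚ - β * β * β) + (2 * (α * α * α) - 3 * ν * (α * α))
    ≡⟨ cong (λ a → ν * ν * (1ℚ - β * β * β) + (2 * (a * a * a) - 3 * ν * (a * a))) α≡1-β ⟩
  ν * ν * (1ℚ - β * β * β) + (2 * ((1ℚ - β) * (1ℚ - β) * (1ℚ - β)) - 3 * ν * ((1ℚ - β) * (1ℚ - β)))
    ≡⟨ cubicGap-complement ν β ⟩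
  ν * ν - cubicGap ν β ∎
  where
  open ℚ.≤-Reasoning
  ν α β : ℚ
  ν = ℕ→ℚ n
  ys zs : List ℚ
  ys = take n xs
  zs = drop n xs
  α = sumℚ ys
  β = sumℚ zs
  α+β≡1 : α + β ≡ 1ℚ
  α+β≡1 = trans (sumℚ-take-drop n xs) Σxs≡1
  0≤α : 0ℚ ≤ α
  0≤α = sumℚ-nonNeg (All.take⁺ n 0≤xs)
  α≤1 : α ≤ 1ℚ
  α≤1 = nonNeg-gap⇒≤ β (sumℚ-nonNeg (All.drop⁺ n 0≤xs)) (sym α+β≡1)
  α≡1-β : α ≡ 1ℚ - β
  α≡1-β = trans (cancel α β) (cong (_- β) α+β≡1)
    where
    cancel : ∀ a b → a ≡ (a + b) - b
    cancel = solve-∀ ℚ-ring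
  ys≤1 : All (_≤ 1ℚ) ys
  ys≤1 = All.take⁺ n (All.map (λ {x} x≤Σ → subst (x ≤_) Σxs≡1 x≤Σ) (All-≤-sumℚ 0≤xs))
  |ys|≡n : length ys ≡ n
  |ys|≡n = trans (length-take n xs) (ℕ.m≤n⇒m⊓n≡m n≤|xs|)
  drop-tail-term : 1ℚ - β * β * β - 3 * α * p₂ zs ≤ 1ℚ - β * β * β
  drop-tail-term = nonNeg-gap⇒≤ (3 * α * p₂ zs) (*-nonNeg (*-nonNeg (ℚ.nonNegative⁻¹ 3) 0≤α) (p₂-nonNeg zs))
                     (add-back (1ℚ - β * β * β) (3 * α * p₂ zs))
    where
    add-back : ∀ a b → a ≡ (a - b) + b
    add-back = solve-∀ ℚ-ring

e₃-meeting-1-bound : ∀ xs → All (0ℚ ≤_) xs → sumℚ xs ≡ 1ℚ → 27 * e₃-meeting 1 xs ≤ 2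
e₃-meeting-1-bound []       _            _     = ℚ.nonNegative⁻¹ 2
e₃-meeting-1-bound (y ∷ ys) (0≤y ∷ 0≤ys) Σ≡1 = *-cancelˡ-≤-pos {r = 2} (ℚ.positive⁻¹ 2) (begin
  2 * (27 * (y * e₂ ys + 0ℚ))          ≡⟨ regroup y (e₂ ys) ⟩
  27 * y * (2 * e₂ ys)                 ≤⟨ *-monoˡ-≤-nonNeg (*-nonNeg (ℚ.nonNegative⁻¹ 27) 0≤y) (2*e₂≤sum² ys) ⟩
  27 * y * (β * β)                     ≡⟨ cong (λ b → 27 * y * (b * b)) β≡1-y ⟩
  27 * y * ((1ℚ - y) * (1ℚ - y))       ≤⟨ nonNeg-gap⇒≤ ((1ℚ - 3 * y) * (1ℚ - 3 * y) * (4 - 3 * y)) 0≤gap (am-gm y) ⟩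
  2 * 2                                ∎)
  where
  open ℚ.≤-Reasoning
  β : ℚ
  β = sumℚ ys
  β≡1-y : β ≡ 1ℚ - y
  β≡1-y = trans (cancel y β) (cong (_- y) Σ≡1)
    where
    cancel : ∀ a b → b ≡ (a + b) - a
    cancel = solve-∀ ℚ-ring
  y≤1 : y ≤ 1ℚ
  y≤1 = nonNeg-gap⇒≤ β (sumℚ-nonNeg 0≤ys) (sym Σ≡1)
  0≤4-3y : 0ℚ ≤ 4 - 3 * y
  0≤4-3y = subst (0ℚ ≤_) (rearrange y)
    (+-nonNeg (*-nonNeg (ℚ.nonNegative⁻¹ 3) (p≤q⇒0≤q-p y≤1)) (ℚ.nonNegative⁻¹ 1))
    where
    rearrange : ∀ y → 3 * (1ℚ - y) + 1 ≡ 4 - 3 * y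
    rearrange = solve-∀ ℚ-ring
  0≤gap : 0ℚ ≤ (1ℚ - 3 * y) * (1ℚ - 3 * y) * (4 - 3 * y)
  0≤gap = *-nonNeg (square-nonNeg (1ℚ - 3 * y)) 0≤4-3y
  regroup : ∀ y e → 2 * (27 * (y * e + 0ℚ)) ≡ 27 * y * (2 * e)
  regroup = solve-∀ ℚ-ring
  am-gm : ∀ y → 2 * 2 ≡ 27 * y * ((1ℚ - y) * (1ℚ - y)) + (1ℚ - 3 * y) * (1ℚ - 3 * y) * (4 - 3 * y)
  am-gm = solve-∀ ℚ-ring

-- Twelve times (2ν + 3) · cubicGap ν u − 3ν², as a polynomial in n = ν − 4 whose
-- coefficients are visibly nonnegative for 0 ≤ u ≤ 1.
cubicGap-certificate : ℚ → ℚ → ℚ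
cubicGap-certificate n u =
  6 * (99 * u * ((2 * u - 1ℚ) * (2 * u - 1ℚ)) + 124 * ((2 * u - 1ℚ) * (2 * u - 1ℚ)) + 32 * u * u + u)
  + 3 * n * (124 * u * ((2 * u - 1ℚ) * (2 * u - 1ℚ)) + 4 * ((13 * u - 5) * (13 * u - 5)) + 12 * (1ℚ - u) + 4)
  + 4 * (n * n) * (9 * u * ((3 * u - 1ℚ) * (3 * u - 1ℚ)) + 8 * ((3 * u - 1ℚ) * (3 * u - 1ℚ)) + 3 * u + 1ℚ)
  + 24 * (n * n * n) * (u * u * u)

cubicGap-certificate-nonNeg : ∀ {n u} → 0ℚ ≤ n → 0ℚ ≤ u → u ≤ 1ℚ → 0ℚ ≤ cubicGap-certificate n u
cubicGap-certificate-nonNeg {n} {u} 0≤n 0≤u u≤1 =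
  +-nonNeg (+-nonNeg (+-nonNeg (*-nonNeg (ℚ.nonNegative⁻¹ 6) 0≤a) (*-nonNeg (*-nonNeg (ℚ.nonNegative⁻¹ 3) 0≤n) 0≤b))
                     (*-nonNeg (*-nonNeg (ℚ.nonNegative⁻¹ 4) (square-nonNeg n)) 0≤c))
           (*-nonNeg (*-nonNeg (ℚ.nonNegative⁻¹ 24) (*-nonNeg (square-nonNeg n) 0≤n)) (*-nonNeg (square-nonNeg u) 0≤u))
  where
  0≤a : 0ℚ ≤ 99 * u * ((2 * u - 1ℚ) * (2 * u - 1ℚ)) + 124 * ((2 * u - 1ℚ) * (2 * u - 1ℚ)) + 32 * u * u + u
  0≤a = +-nonNeg (+-nonNeg (+-nonNeg (*-nonNeg (*-nonNeg (ℚ.nonNegative⁻¹ 99) 0≤u) (square-nonNeg (2 * u - 1ℚ)))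
                                     (*-nonNeg (ℚ.nonNegative⁻¹ 124) (square-nonNeg (2 * u - 1ℚ))))
                           (*-nonNeg (*-nonNeg (ℚ.nonNegative⁻¹ 32) 0≤u) 0≤u)) 0≤u
  0≤b : 0ℚ ≤ 124 * u * ((2 * u - 1ℚ) * (2 * u - 1ℚ)) + 4 * ((13 * u - 5) * (13 * u - 5)) + 12 * (1ℚ - u) + 4
  0≤b = +-nonNeg (+-nonNeg (+-nonNeg (*-nonNeg (*-nonNeg (ℚ.nonNegative⁻¹ 124) 0≤u) (square-nonNeg (2 * u - 1ℚ)))
                                     (*-nonNeg (ℚ.nonNegative⁻¹ 4) (square-nonNeg (13 * u - 5))))
                           (*-nonNeg (ℚ.nonNegative⁻¹ 12) (p≤q⇒0≤q-p u≤1))) (ℚ.nonNegative⁻¹ 4)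
  0≤c : 0ℚ ≤ 9 * u * ((3 * u - 1ℚ) * (3 * u - 1ℚ)) + 8 * ((3 * u - 1ℚ) * (3 * u - 1ℚ)) + 3 * u + 1ℚ
  0≤c = +-nonNeg (+-nonNeg (+-nonNeg (*-nonNeg (*-nonNeg (ℚ.nonNegative⁻¹ 9) 0≤u) (square-nonNeg (3 * u - 1ℚ)))
                                     (*-nonNeg (ℚ.nonNegative⁻¹ 8) (square-nonNeg (3 * u - 1ℚ))))
                           (*-nonNeg (ℚ.nonNegative⁻¹ 3) 0≤u)) (ℚ.nonNegative⁻¹ 1)

cubicGap-lower : ∀ {ν u} → 4 ≤ ν → 0ℚ ≤ u → u ≤ 1ℚ → 3 * ν * ν ≤ (2 * ν + 3) * cubicGap ν u
cubicGap-lower {ν} {u} 4≤ν 0≤u u≤1 = *-cancelˡ-≤-pos {r = 12} (ℚ.positive⁻¹ 12)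
  (nonNeg-gap⇒≤ (cubicGap-certificate (ν - 4) u) (cubicGap-certificate-nonNeg (p≤q⇒0≤q-p 4≤ν) 0≤u u≤1) (expand ν u))
  where
  expand : ∀ ν u →
    12 * ((2 * ν + 3) * (ν * ν * (u * u * u) + (1ℚ - u) * (1ℚ - u) * (3 * ν - 2 * (1ℚ - u))))
    ≡ 12 * (3 * ν * ν)
      + (6 * (99 * u * ((2 * u - 1ℚ) * (2 * u - 1ℚ)) + 124 * ((2 * u - 1ℚ) * (2 * u - 1ℚ)) + 32 * u * u + u)
         + 3 * (ν - 4) * (124 * u * ((2 * u - 1ℚ) * (2 * u - 1ℚ)) + 4 * ((13 * u - 5) * (13 * u - 5)) + 12 * (1ℚ - u) + 4)
         + 4 * ((ν - 4) * (ν - 4)) * (9 * u * ((3 * u - 1ℚ) * (3 * u - 1ℚ)) + 8 * ((3 * u - 1ℚ) * (3 * u - 1ℚ)) + 3 * u + 1ℚ)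
         + 24 * ((ν - 4) * (ν - 4) * (ν - 4)) * (u * u * u))
  expand = solve-∀ ℚ-ring

weight-nonNeg : ∀ {κ} → 0ℚ ≤ κ → 0ℚ ≤ 6 * (6 + κ) * (7 + κ)
weight-nonNeg 0≤κ = *-nonNeg (*-nonNeg (ℚ.nonNegative⁻¹ 6) (+-nonNeg (ℚ.nonNegative⁻¹ 6) 0≤κ))
                             (+-nonNeg (ℚ.nonNegative⁻¹ 7) 0≤κ)

bound-from-cubicGap : ∀ {ν κ u S} → 0ℚ ≤ κ → 4 ≤ ν → 2 * ν ≤ 4 + κ → 0ℚ ≤ u → u ≤ 1ℚ →
  ν * ν * (6 * S) ≤ ν * ν - cubicGap ν u → S * (6 * (6 + κ) * (7 + κ)) ≤ (5 + κ) * (5 + κ)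
bound-from-cubicGap {ν} {κ} {u} {S} 0≤κ 4≤ν 2ν≤4+κ 0≤u u≤1 bound = *-cancelˡ-≤-pos 0<νν (begin
  ν * ν * (S * (6 * (6 + κ) * (7 + κ)))      ≡⟨ regroup ν κ S ⟩
  ν * ν * (6 * S) * ((6 + κ) * (7 + κ))      ≤⟨ *-monoʳ-≤-nonNeg 0≤W bound ⟩
  (ν * ν - γ) * ((6 + κ) * (7 + κ))          ≤⟨ nonNeg-gap⇒≤ gap 0≤gap (expand ν κ γ) ⟩
  ν * ν * ((5 + κ) * (5 + κ))                ∎)
  where
  open ℚ.≤-Reasoning
  γ : ℚ
  γ = cubicGap ν u
  0<ν : 0ℚ < ν
  0<ν = ℚ.<-≤-trans (ℚ.positive⁻¹ 4) 4≤ν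
  0<νν : 0ℚ < ν * ν
  0<νν = *-pos 0<ν 0<ν
  0<2ν+3 : 0ℚ < 2 * ν + 3
  0<2ν+3 = ℚ.≤-<-trans (*-nonNeg (ℚ.nonNegative⁻¹ 2) (ℚ.<⇒≤ 0<ν)) (pos-gap⇒< 3 (ℚ.positive⁻¹ 3) refl)
  3νν≤[2ν+3]γ : 3 * ν * ν ≤ (2 * ν + 3) * γ
  3νν≤[2ν+3]γ = cubicGap-lower 4≤ν 0≤u u≤1
  0≤γ : 0ℚ ≤ γ
  0≤γ = *-cancelˡ-≤-pos 0<2ν+3 (ℚ.≤-trans (ℚ.≤-reflexive (ℚ.*-zeroʳ (2 * ν + 3)))
          (ℚ.≤-trans (*-nonNeg (*-nonNeg (ℚ.nonNegative⁻¹ 3) (ℚ.<⇒≤ 0<ν)) (ℚ.<⇒≤ 0<ν)) 3νν≤[2ν+3]γ))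
  0≤6+κ : 0ℚ ≤ 6 + κ
  0≤6+κ = +-nonNeg (ℚ.nonNegative⁻¹ 6) 0≤κ
  0≤W : 0ℚ ≤ (6 + κ) * (7 + κ)
  0≤W = *-nonNeg 0≤6+κ (+-nonNeg (ℚ.nonNegative⁻¹ 7) 0≤κ)
  gap : ℚ
  gap = (6 + κ) * (((4 + κ) - 2 * ν) * γ + ((2 * ν + 3) * γ - 3 * ν * ν)) + ν * ν
  0≤gap : 0ℚ ≤ gap
  0≤gap = +-nonNeg (*-nonNeg 0≤6+κ (+-nonNeg (*-nonNeg (p≤q⇒0≤q-p 2ν≤4+κ) 0≤γ) (p≤q⇒0≤q-p 3νν≤[2ν+3]γ)))
                   (square-nonNeg ν)
  regroup : ∀ ν κ S → ν * ν * (S * (6 * (6 + κ) * (7 + κ))) ≡ ν * ν * (6 * S) * ((6 + κ) * (7 + κ))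
  regroup = solve-∀ ℚ-ring
  expand : ∀ ν κ γ → ν * ν * ((5 + κ) * (5 + κ))
    ≡ (ν * ν - γ) * ((6 + κ) * (7 + κ)) + ((6 + κ) * (((4 + κ) - 2 * ν) * γ + ((2 * ν + 3) * γ - 3 * ν * ν)) + ν * ν)
  expand = solve-∀ ℚ-ring

bound-from-2/27 : ∀ {κ S} → 0ℚ ≤ κ → 27 * S ≤ 2 → S * (6 * (6 + κ) * (7 + κ)) ≤ (5 + κ) * (5 + κ)
bound-from-2/27 {κ} {S} 0≤κ bound = *-cancelˡ-≤-pos {r = 27} (ℚ.positive⁻¹ 27) (begin
  27 * (S * (6 * (6 + κ) * (7 + κ)))   ≡⟨ regroup κ S ⟩
  27 * S * (6 * (6 + κ) * (7 + κ))     ≤⟨ *-monoʳ-≤-nonNeg (weight-nonNeg 0≤κ) bound ⟩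
  2 * (6 * (6 + κ) * (7 + κ))          ≤⟨ nonNeg-gap⇒≤ gap 0≤gap (expand κ) ⟩
  27 * ((5 + κ) * (5 + κ))             ∎)
  where
  open ℚ.≤-Reasoning
  gap : ℚ
  gap = 171 + κ * (114 + 15 * κ)
  0≤gap : 0ℚ ≤ gap
  0≤gap = +-nonNeg (ℚ.nonNegative⁻¹ 171) (*-nonNeg 0≤κ (+-nonNeg (ℚ.nonNegative⁻¹ 114) (*-nonNeg (ℚ.nonNegative⁻¹ 15) 0≤κ)))
  regroup : ∀ κ S → 27 * (S * (6 * (6 + κ) * (7 + κ))) ≡ 27 * S * (6 * (6 + κ) * (7 + κ))
  regroup = solve-∀ ℚ-ring
  expand : ∀ κ → 27 * ((5 + κ) * (5 + κ)) ≡ 2 * (6 * (6 + κ) * (7 + κ)) + (171 + κ * (114 + 15 * κ))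
  expand = solve-∀ ℚ-ring

-- The Lagrangian polynomial as a symmetric function

sumℚ-filterᵇ-++-≤ : ∀ (g : A → ℚ) p xs ys → All (λ a → 0ℚ ≤ g a) xs → All (λ a → ¬ T (p a)) ys →
  sumℚ (map g (filterᵇ p (xs ++ ys))) ≤ sumℚ (map g xs)
sumℚ-filterᵇ-++-≤ g p []       ys []           ¬pys = ℚ.≤-reflexive (cong (sumℚ ∘ map g) (filter-none (T? ∘ p) ¬pys))
sumℚ-filterᵇ-++-≤ g p (x ∷ xs) ys (0≤gx ∷ 0≤g) ¬pys with p x
... | true  = ℚ.+-monoʳ-≤ (g x) (sumℚ-filterᵇ-++-≤ g p xs ys 0≤g ¬pys)
... | false = ℚ.≤-trans (sumℚ-filterᵇ-++-≤ g p xs ys 0≤g ¬pys) (nonNeg-gap⇒≤ (g x) 0≤gx (ℚ.+-comm (g x) _))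

filterᵇ-map : ∀ (p : B → Bool) (f : A → B) xs → filterᵇ p (map f xs) ≡ map f (filterᵇ (p ∘ f) xs)
filterᵇ-map p f []       = refl
filterᵇ-map p f (x ∷ xs) with p (f x)
... | true  = cong (f x ∷_) (filterᵇ-map p f xs)
... | false = filterᵇ-map p f xs

filterᵇ-allFin-< : ∀ t m → filterᵇ (λ k → m ℕ.<ᵇ toℕ k) (allFin t) ≡ drop (suc m) (allFin t)
filterᵇ-allFin-< zero    m       = refl
filterᵇ-allFin-< (suc t) zero    = filter-all (T? ∘ (λ k → 0 ℕ.<ᵇ toℕ k)) (All.tabulate⁺ (λ _ → tt))
filterᵇ-allFin-< (suc t) (suc m) = begin
  filterᵇ p (tabulate Fin.suc)                 ≡⟨ cong (filterᵇ p) (map-tabulate id Fin.suc) ⟨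
  filterᵇ p (map Fin.suc (allFin t))           ≡⟨ filterᵇ-map p Fin.suc (allFin t) ⟩
  map Fin.suc (filterᵇ (p ∘ Fin.suc) (allFin t)) ≡⟨ cong (map Fin.suc) (filterᵇ-allFin-< t m) ⟩
  map Fin.suc (drop (suc m) (allFin t))        ≡⟨ drop-map (suc m) (allFin t) ⟨
  drop (suc m) (map Fin.suc (allFin t))        ≡⟨ cong (drop (suc m)) (map-tabulate id Fin.suc) ⟩
  drop (suc m) (tabulate Fin.suc)              ∎
  where
  open ≡-Reasoning
  p : Fin (suc t) → Bool
  p k = suc m ℕ.<ᵇ toℕ k

drop-allFin-≥ : ∀ {t} n → All (λ i → n ℕ.≤ toℕ i) (drop n (allFin t))
drop-allFin-≥ {t} zero    = All.universal (λ _ → ℕ.z≤n) (allFin t)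
drop-allFin-≥ {t} (suc m) = subst (All (λ i → suc m ℕ.≤ toℕ i)) (filterᵇ-allFin-< t m)
  (All.map (λ {i} → ℕ.<ᵇ⇒< m (toℕ i)) (All.all-filter (T? ∘ (λ k → m ℕ.<ᵇ toℕ k)) (allFin t)))

above : ∀ {t} → Fin t → List (Fin t)
above {t} j = filterᵇ (λ k → ⌊ j <? k ⌋) (allFin t)

above-> : ∀ {t} (j : Fin t) → All (λ k → toℕ j ℕ.< toℕ k) (above j)
above-> {t} j = All.map toWitness (All.all-filter (T? ∘ (λ k → ⌊ j <? k ⌋)) (allFin t))

map-above : ∀ {t} (f : Fin t → A) j → map f (above j) ≡ drop (suc (toℕ j)) (tabulate f)
map-above {t = t} f j = begin
  map f (filterᵇ (λ k → ⌊ j <? k ⌋) (allFin t))         ≡⟨ cong (map f) (filter-≐ (T? ∘ _) (T? ∘ _) (same , same⁻¹) (allFin t)) ⟩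
  map f (filterᵇ (λ k → toℕ j ℕ.<ᵇ toℕ k) (allFin t))   ≡⟨ cong (map f) (filterᵇ-allFin-< t (toℕ j)) ⟩
  map f (drop (suc (toℕ j)) (allFin t))                 ≡⟨ drop-map (suc (toℕ j)) (allFin t) ⟨
  drop (suc (toℕ j)) (map f (allFin t))                 ≡⟨ cong (drop (suc (toℕ j))) (map-tabulate id f) ⟩
  drop (suc (toℕ j)) (tabulate f)                       ∎
  where
  open ≡-Reasoning
  same : ∀ {k} → T ⌊ j <? k ⌋ → T (toℕ j ℕ.<ᵇ toℕ k)
  same {k} = subst T (isYes≗does (j <? k))
  same⁻¹ : ∀ {k} → T (toℕ j ℕ.<ᵇ toℕ k) → T ⌊ j <? k ⌋
  same⁻¹ {k} = subst T (sym (isYes≗does (j <? k)))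

Triple : ℕ → Set
Triple t = Fin t × Fin t × Fin t

-- triples t is concatMap triplesFrom (allFin t) by definition.
triplesFrom : ∀ {t} → Fin t → List (Triple t)
triplesFrom i = concatMap (λ j → map (λ k → (i , j , k)) (above j)) (above i)

All-triplesFrom : ∀ {t} {P : Triple t → Set} i →
  (∀ j k → toℕ i ℕ.< toℕ j → toℕ j ℕ.< toℕ k → P (i , j , k)) → All P (triplesFrom i)
All-triplesFrom i P-increasing = All.concat⁺ (All.map⁺ (All.map
  (λ {j} i<j → All.map⁺ (All.map (λ {k} j<k → P-increasing j k i<j j<k) (above-> j)))
  (above-> i)))

monomial : ∀ {t} → (Fin t → ℚ) → Triple t → ℚ
monomial x (i , j , k) = x i * x j * x k

monomial-nonNeg : ∀ {t} {x : Fin t → ℚ} → (∀ i → 0ℚ ≤ x i) → ∀ z → 0ℚ ≤ monomial x z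
monomial-nonNeg 0≤x (i , j , k) = *-nonNeg (*-nonNeg (0≤x i) (0≤x j)) (0≤x k)

withAfter : ∀ {t} → (Fin t → A) → Fin t → A × List A
withAfter x i = x i , drop (suc (toℕ i)) (tabulate x)

tabulate-withAfter : ∀ {t} (x : Fin t → A) → tabulate (withAfter x) ≡ withTails (tabulate x)
tabulate-withAfter {t = zero}  x = refl
tabulate-withAfter {t = suc t} x = cong ((x Fin.zero , tabulate (x ∘ Fin.suc)) ∷_) (tabulate-withAfter (x ∘ Fin.suc))

sum-monomial-triplesFrom : ∀ {t} (x : Fin t → ℚ) i → sumℚ (map (monomial x) (triplesFrom i)) ≡ e₃-term (withAfter x i)
sum-monomial-triplesFrom {t} x i = begin
  sumℚ (map (monomial x) (concatMap (λ j → map (λ k → (i , j , k)) (above j)) (above i)))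
    ≡⟨ sumℚ-concatMap (monomial x) (λ j → map (λ k → (i , j , k)) (above j)) (above i) ⟩
  sumℚ (map (λ j → sumℚ (map (monomial x) (map (λ k → (i , j , k)) (above j)))) (above i))
    ≡⟨ cong sumℚ (map-cong inner (above i)) ⟩
  sumℚ (map (λ j → x i * e₂-term (withAfter x j)) (above i))
    ≡⟨ sumℚ-scale (x i) (e₂-term ∘ withAfter x) (above i) ⟩
  x i * sumℚ (map (e₂-term ∘ withAfter x) (above i))
    ≡⟨ cong (λ ws → x i * sumℚ ws) (map-∘ (above i)) ⟩
  x i * sumℚ (map e₂-term (map (withAfter x) (above i)))
    ≡⟨ cong (λ ws → x i * sumℚ (map e₂-term ws)) (map-above (withAfter x) i) ⟩
  x i * sumℚ (map e₂-term (drop (suc (toℕ i)) (tabulate (withAfter x))))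
    ≡⟨ cong (λ ws → x i * sumℚ (map e₂-term (drop (suc (toℕ i)) ws))) (tabulate-withAfter x) ⟩
  x i * sumℚ (map e₂-term (drop (suc (toℕ i)) (withTails (tabulate x))))
    ≡⟨ cong (λ ws → x i * sumℚ (map e₂-term ws)) (withTails-drop (suc (toℕ i)) (tabulate x)) ⟨
  x i * e₂ (drop (suc (toℕ i)) (tabulate x)) ∎
  where
  open ≡-Reasoning
  inner : ∀ j → sumℚ (map (monomial x) (map (λ k → (i , j , k)) (above j))) ≡ x i * e₂-term (withAfter x j)
  inner j = begin
    sumℚ (map (monomial x) (map (λ k → (i , j , k)) (above j)))  ≡⟨ cong sumℚ (map-∘ (above j)) ⟨
    sumℚ (map (λ k → x i * x j * x k) (above j))                 ≡⟨ sumℚ-scale (x i * x j) x (above j) ⟩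
    x i * x j * sumℚ (map x (above j))                           ≡⟨ cong (λ ws → x i * x j * sumℚ ws) (map-above x j) ⟩
    x i * x j * sumℚ (drop (suc (toℕ j)) (tabulate x))           ≡⟨ ℚ.*-assoc (x i) (x j) _ ⟩
    x i * e₂-term (withAfter x j)                                ∎

sum-monomial-concatMap : ∀ {t} (x : Fin t → ℚ) is →
  sumℚ (map (monomial x) (concatMap triplesFrom is)) ≡ sumℚ (map e₃-term (map (withAfter x) is))
sum-monomial-concatMap x is = trans (sumℚ-concatMap (monomial x) triplesFrom is)
  (cong sumℚ (trans (map-cong (sum-monomial-triplesFrom x) is) (map-∘ is)))

sum-monomial-triples : ∀ {t} (x : Fin t → ℚ) → sumℚ (map (monomial x) (triples t)) ≡ e₃ (tabulate x)
sum-monomial-triples {t} x = trans (sum-monomial-concatMap x (allFin t))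
  (cong (sumℚ ∘ map e₃-term) (trans (map-tabulate id (withAfter x)) (tabulate-withAfter x)))

sum-monomial-meeting : ∀ {t} (x : Fin t → ℚ) n →
  sumℚ (map (monomial x) (concatMap triplesFrom (take n (allFin t)))) ≡ e₃-meeting n (tabulate x)
sum-monomial-meeting {t} x n = trans (sum-monomial-concatMap x (take n (allFin t)))
  (cong (sumℚ ∘ map e₃-term) (trans (sym (take-map n (allFin t)))
    (cong (take n) (trans (map-tabulate id (withAfter x)) (tabulate-withAfter x)))))

edge? : ∀ {t} → Edges t → Triple t → Bool
edge? E (i , j , k) = E i j k

lagPoly-≤-e₃-meeting : ∀ {t} (E : Edges t) n (x : Fin t → ℚ) → (∀ i → 0ℚ ≤ x i) →
  (∀ i j k → toℕ i ℕ.< toℕ j → toℕ j ℕ.< toℕ k → E i j k ≡ true → toℕ i ℕ.< n) →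
  lagPoly E x ≤ e₃-meeting n (tabulate x)
lagPoly-≤-e₃-meeting {t} E n x 0≤x edge-meets = begin
  lagPoly E x
    ≡⟨ cong (sumℚ ∘ map (monomial x) ∘ filterᵇ (edge? E))
            (trans (cong (concatMap triplesFrom) (sym (take++drop≡id n (allFin t))))
                   (concatMap-++ triplesFrom (take n (allFin t)) (drop n (allFin t)))) ⟩
  sumℚ (map (monomial x) (filterᵇ (edge? E) (concatMap triplesFrom (take n (allFin t))
                                              ++ concatMap triplesFrom (drop n (allFin t)))))
    ≤⟨ sumℚ-filterᵇ-++-≤ (monomial x) (edge? E) (concatMap triplesFrom (take n (allFin t))) _
         (All.universal (monomial-nonNeg 0≤x) _) no-edges-beyond ⟩
  sumℚ (map (monomial x) (concatMap triplesFrom (take n (allFin t))))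
    ≡⟨ sum-monomial-meeting x n ⟩
  e₃-meeting n (tabulate x) ∎
  where
  open ℚ.≤-Reasoning
  no-edges-beyond : All (λ z → ¬ T (edge? E z)) (concatMap triplesFrom (drop n (allFin t)))
  no-edges-beyond = All.concat⁺ (All.map⁺ (All.map
    (λ {i} n≤i → All-triplesFrom i (λ j k i<j j<k e → ℕ.<⇒≱ (edge-meets i j k i<j j<k (Equivalence.to T-≡ e)) n≤i))
    (drop-allFin-≥ n)))

lagPoly-Complete : ∀ n (x : Fin n → ℚ) → lagPoly (Complete n) x ≡ e₃ (tabulate x)
lagPoly-Complete n x = trans (cong (sumℚ ∘ map (monomial x)) (filter-all (T? ∘ edge? (Complete n)) all-edges))
  (sum-monomial-triples x)
  where
  distinct : ∀ {a b : Fin n} → toℕ a ℕ.< toℕ b → T (not ⌊ a ≟ b ⌋)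
  distinct {a} {b} a<b with a ≟ b
  ... | yes refl = ℕ.<-irrefl refl a<b
  ... | no _     = tt
  all-edges : All (T ∘ edge? (Complete n)) (triples n)
  all-edges = All.concat⁺ (All.map⁺ (All.universal
    (λ i → All-triplesFrom i (λ j k i<j j<k →
      Equivalence.from T-∧ (distinct i<j , Equivalence.from T-∧ (distinct (ℕ.<-trans i<j j<k) , distinct j<k))))
    (allFin n)))

-- Left-compressed 3-graphs without large cliques

compressed-increasing : ∀ {t} {E : Edges t} → LeftCompressed E → ∀ {i₁ i₂ i₃ j₁ j₂ j₃} →
  E j₁ j₂ j₃ ≡ true → toℕ i₁ ℕ.< toℕ i₂ → toℕ i₂ ℕ.< toℕ i₃ →
  toℕ i₁ ℕ.≤ toℕ j₁ → toℕ i₂ ℕ.≤ toℕ j₂ → toℕ i₃ ℕ.≤ toℕ j₃ → E i₁ i₂ i₃ ≡ true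
compressed-increasing compressed e i₁<i₂ i₂<i₃ =
  compressed _ _ _ _ _ _ e (Fin.<⇒≢ i₁<i₂) (Fin.<⇒≢ (ℕ.<-trans i₁<i₂ i₂<i₃)) (Fin.<⇒≢ i₂<i₃)

module _ {t} {E : Edges t} (isGraph : Is3Graph E) where
  open Is3Graph isGraph

  edge-of-increasing : ∀ {s} (f : Fin s → Fin t) →
    (∀ p q r → toℕ p ℕ.< toℕ q → toℕ q ℕ.< toℕ r → E (f p) (f q) (f r) ≡ true) →
    ∀ p q r → p ≢ q → p ≢ r → q ≢ r → E (f p) (f q) (f r) ≡ true
  edge-of-increasing f increasing p q r p≢q p≢r q≢r with Fin.<-cmp p q | Fin.<-cmp q r | Fin.<-cmp p r
  ... | tri≈ _ p≡q _ | _            | _            = contradiction p≡q p≢q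
  ... | _            | tri≈ _ q≡r _ | _            = contradiction q≡r q≢r
  ... | _            | _            | tri≈ _ p≡r _ = contradiction p≡r p≢r
  ... | tri< p<q _ _ | tri< q<r _ _ | _            = increasing p q r p<q q<r
  ... | tri< p<q _ _ | tri> _ _ r<q | tri< p<r _ _ =
    trans (swap₂₃ (f p) (f q) (f r)) (increasing p r q p<r r<q)
  ... | tri< p<q _ _ | tri> _ _ r<q | tri> _ _ r<p =
    trans (swap₂₃ (f p) (f q) (f r)) (trans (swap₁₂ (f p) (f r) (f q)) (increasing r p q r<p p<q))
  ... | tri> _ _ q<p | tri< q<r _ _ | tri< p<r _ _ =
    trans (swap₁₂ (f p) (f q) (f r)) (increasing q p r q<p p<r)
  ... | tri> _ _ q<p | tri< q<r _ _ | tri> _ _ r<p =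
    trans (swap₁₂ (f p) (f q) (f r)) (trans (swap₂₃ (f q) (f p) (f r)) (increasing q r p q<r r<p))
  ... | tri> _ _ q<p | tri> _ _ r<q | _            =
    trans (swap₁₂ (f p) (f q) (f r)) (trans (swap₂₃ (f q) (f p) (f r))
      (trans (swap₁₂ (f q) (f r) (f p)) (increasing r q p r<q q<p)))

-- The edge i < j < k with a ≤ i dominates every increasing triple of [a + 3] coordinatewise.
clique-of-high-edge : ∀ {t a} {E : Edges t} → Is3Graph E → LeftCompressed E → 3 ℕ.+ a ℕ.≤ t →
  ∀ {i j k} → toℕ i ℕ.< toℕ j → toℕ j ℕ.< toℕ k → E i j k ≡ true → a ℕ.≤ toℕ i → HasClique E (3 ℕ.+ a)
clique-of-high-edge {a = a} {E} isGraph compressed 3+a≤t {i} {j} {k} i<j j<k e a≤i =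
  f , Fin.inject≤-injective 3+a≤t 3+a≤t , edge-of-increasing isGraph f increasing
  where
  f : Fin (3 ℕ.+ a) → Fin _
  f p = Fin.inject≤ p 3+a≤t
  toℕ-f : ∀ p → toℕ (f p) ≡ toℕ p
  toℕ-f p = Fin.toℕ-inject≤ p 3+a≤t
  increasing : ∀ p q r → toℕ p ℕ.< toℕ q → toℕ q ℕ.< toℕ r → E (f p) (f q) (f r) ≡ true
  increasing p q r p<q q<r = compressed-increasing compressed e
    (subst₂ ℕ._<_ (sym (toℕ-f p)) (sym (toℕ-f q)) p<q) (subst₂ ℕ._<_ (sym (toℕ-f q)) (sym (toℕ-f r)) q<r)
    (subst (ℕ._≤ toℕ i) (sym (toℕ-f p)) (ℕ.≤-trans p≤a a≤i))
    (subst (ℕ._≤ toℕ j) (sym (toℕ-f q)) (ℕ.≤-trans q≤1+a (ℕ.≤-<-trans a≤i i<j)))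
    (subst (ℕ._≤ toℕ k) (sym (toℕ-f r)) (ℕ.≤-trans r≤2+a (ℕ.≤-<-trans (ℕ.≤-<-trans a≤i i<j) j<k)))
    where
    r≤2+a : toℕ r ℕ.≤ 2 ℕ.+ a
    r≤2+a = ℕ.s≤s⁻¹ (Fin.toℕ<n r)
    q≤1+a : toℕ q ℕ.≤ 1 ℕ.+ a
    q≤1+a = ℕ.s≤s⁻¹ (ℕ.<-≤-trans q<r r≤2+a)
    p≤a : toℕ p ℕ.≤ a
    p≤a = ℕ.s≤s⁻¹ (ℕ.<-≤-trans p<q q≤1+a)

edges-meet-prefix : ∀ {t a} {E : Edges t} → Is3Graph E → LeftCompressed E → ¬ HasClique E (3 ℕ.+ a) →
  3 ℕ.+ a ℕ.≤ t → ∀ i j k → toℕ i ℕ.< toℕ j → toℕ j ℕ.< toℕ k → E i j k ≡ true → toℕ i ℕ.< a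
edges-meet-prefix {a = a} isGraph compressed no-clique 3+a≤t i j k i<j j<k e with toℕ i ℕ.<? a
... | yes i<a = i<a
... | no  i≮a = contradiction (clique-of-high-edge isGraph compressed 3+a≤t i<j j<k e (ℕ.≮⇒≥ i≮a)) no-clique

no-three-distinct-in-Fin2 : (p q r : Fin 2) → p ≢ q → p ≢ r → q ≢ r → ⊥
no-three-distinct-in-Fin2 Fin.zero           Fin.zero           _                  p≢q _   _   = p≢q refl
no-three-distinct-in-Fin2 (Fin.suc Fin.zero) (Fin.suc Fin.zero) _                  p≢q _   _   = p≢q refl
no-three-distinct-in-Fin2 Fin.zero           (Fin.suc Fin.zero) Fin.zero           _   p≢r _   = p≢r refl
no-three-distinct-in-Fin2 Fin.zero           (Fin.suc Fin.zero) (Fin.suc Fin.zero) _   _   q≢r = q≢r refl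
no-three-distinct-in-Fin2 (Fin.suc Fin.zero) Fin.zero           Fin.zero           _   _   q≢r = q≢r refl
no-three-distinct-in-Fin2 (Fin.suc Fin.zero) Fin.zero           (Fin.suc Fin.zero) _   p≢r _   = p≢r refl

small-clique : ∀ {t s} (E : Edges t) → s ℕ.≤ 2 → s ℕ.≤ t → HasClique E s
small-clique E s≤2 s≤t =
  (λ p → Fin.inject≤ p s≤t) , Fin.inject≤-injective s≤t s≤t ,
  λ p q r p≢q p≢r q≢r → ⊥-elim (no-three-distinct-in-Fin2 (into p) (into q) (into r)
    (p≢q ∘ into-injective p q) (p≢r ∘ into-injective p r) (q≢r ∘ into-injective q r))
  where
  into : Fin _ → Fin 2
  into p = Fin.inject≤ p s≤2
  into-injective : ∀ p q → into p ≡ into q → p ≡ q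
  into-injective = Fin.inject≤-injective s≤2 s≤2

weight-ℚ : ∀ k → ℕ→ℚ (6 *ℕ (6 ℕ.+ k) *ℕ (7 ℕ.+ k)) ≡ 6 * (6 + ℕ→ℚ k) * (7 + ℕ→ℚ k)
weight-ℚ k = trans (ℕ→ℚ-* (6 *ℕ (6 ℕ.+ k)) (7 ℕ.+ k))
  (cong₂ _*_ (trans (ℕ→ℚ-* 6 (6 ℕ.+ k)) (cong (6 *_) (ℕ→ℚ-+ 6 k))) (ℕ→ℚ-+ 7 k))

square-ℚ : ∀ k → ℕ→ℚ ((5 ℕ.+ k) ^ 2) ≡ (5 + ℕ→ℚ k) * (5 + ℕ→ℚ k)
square-ℚ k = trans (cong (λ m → ℕ→ℚ ((5 ℕ.+ k) *ℕ m)) (ℕ.*-identityʳ (5 ℕ.+ k)))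
  (trans (ℕ→ℚ-* (5 ℕ.+ k) (5 ℕ.+ k)) (cong₂ _*_ (ℕ→ℚ-+ 5 k) (ℕ→ℚ-+ 5 k)))

simplex-nonNeg : ∀ {t} {x : Fin t → ℚ} → InSimplex x → All (0ℚ ≤_) (tabulate x)
simplex-nonNeg (0≤x , _) = All.tabulate⁺ 0≤x

simplex-sum : ∀ {t} {x : Fin t → ℚ} → InSimplex x → sumℚ (tabulate x) ≡ 1ℚ
simplex-sum {x = x} (_ , Σx≡1) = trans (cong sumℚ (sym (map-tabulate id x))) Σx≡1

bound-from-vertex : ∀ k (E : Edges (8 ℕ.+ k)) x → InSimplex x →
  (∀ i j l → toℕ i ℕ.< toℕ j → toℕ j ℕ.< toℕ l → E i j l ≡ true → toℕ i ℕ.< 1) →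
  lagPoly E x * (6 * (6 + ℕ→ℚ k) * (7 + ℕ→ℚ k)) ≤ (5 + ℕ→ℚ k) * (5 + ℕ→ℚ k)
bound-from-vertex k E x x∈Δ edges-meet = ℚ.≤-trans
  (*-monoʳ-≤-nonNeg 0≤W (lagPoly-≤-e₃-meeting E 1 x (proj₁ x∈Δ) edges-meet))
  (bound-from-2/27 {S = e₃-meeting 1 (tabulate x)} (ℕ→ℚ-nonNeg k)
    (e₃-meeting-1-bound (tabulate x) (simplex-nonNeg x∈Δ) (simplex-sum x∈Δ)))
  where
  0≤W : 0ℚ ≤ 6 * (6 + ℕ→ℚ k) * (7 + ℕ→ℚ k)
  0≤W = weight-nonNeg (ℕ→ℚ-nonNeg k)

bound-from-prefix : ∀ k n (E : Edges (8 ℕ.+ k)) x → InSimplex x → 4 ℕ.≤ n → 2 *ℕ n ℕ.≤ 4 ℕ.+ k →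
  (∀ i j l → toℕ i ℕ.< toℕ j → toℕ j ℕ.< toℕ l → E i j l ≡ true → toℕ i ℕ.< n) →
  lagPoly E x * (6 * (6 + ℕ→ℚ k) * (7 + ℕ→ℚ k)) ≤ (5 + ℕ→ℚ k) * (5 + ℕ→ℚ k)
bound-from-prefix k n E x x∈Δ 4≤n 2n≤4+k edges-meet = ℚ.≤-trans
  (*-monoʳ-≤-nonNeg 0≤W (lagPoly-≤-e₃-meeting E n x (proj₁ x∈Δ) edges-meet))
  (bound-from-cubicGap {S = e₃-meeting n xs} (ℕ→ℚ-nonNeg k) (ℕ→ℚ-mono-≤ 4≤n) 2ν≤4+κ 0≤β β≤1
    (e₃-meeting-cubicGap-bound n xs 0≤xs Σxs≡1 n≤|xs| 4≤n))
  where
  xs : List ℚ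
  xs = tabulate x
  0≤xs : All (0ℚ ≤_) xs
  0≤xs = simplex-nonNeg x∈Δ
  Σxs≡1 : sumℚ xs ≡ 1ℚ
  Σxs≡1 = simplex-sum x∈Δ
  n≤|xs| : n ℕ.≤ length xs
  n≤|xs| = subst (n ℕ.≤_) (sym (length-tabulate x))
    (ℕ.≤-trans (ℕ.m≤n*m n 2) (ℕ.≤-trans 2n≤4+k (ℕ.+-monoˡ-≤ k (ℕ.m≤m+n 4 4))))
  2ν≤4+κ : 2 * ℕ→ℚ n ≤ 4 + ℕ→ℚ k
  2ν≤4+κ = subst₂ _≤_ (ℕ→ℚ-* 2 n) (ℕ→ℚ-+ 4 k) (ℕ→ℚ-mono-≤ 2n≤4+k)
  0≤β : 0ℚ ≤ sumℚ (drop n xs)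
  0≤β = sumℚ-nonNeg (All.drop⁺ n 0≤xs)
  β≤1 : sumℚ (drop n xs) ≤ 1ℚ
  β≤1 = nonNeg-gap⇒≤ (sumℚ (take n xs)) (sumℚ-nonNeg (All.take⁺ n 0≤xs))
    (trans (sym (trans (sumℚ-take-drop n xs) Σxs≡1)) (ℚ.+-comm (sumℚ (take n xs)) (sumℚ (drop n xs))))
  0≤W : 0ℚ ≤ 6 * (6 + ℕ→ℚ k) * (7 + ℕ→ℚ k)
  0≤W = weight-nonNeg (ℕ→ℚ-nonNeg k)

clique-order-split : ∀ k → let a = (6 ℕ.+ k) / 2 ∸ 3 in 3 ℕ.+ a ≡ (6 ℕ.+ k) / 2 × 2 *ℕ a ℕ.≤ k
clique-order-split k = ℕ.m+[n∸m]≡n 3≤s , (begin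
  2 *ℕ (s ∸ 3)      ≡⟨ ℕ.*-distribˡ-∸ 2 s 3 ⟩
  2 *ℕ s ∸ 6        ≤⟨ ℕ.∸-monoˡ-≤ 6 (ℕ.≤-trans (ℕ.≤-reflexive (ℕ.*-comm 2 s)) (ℕ.m/n*n≤m (6 ℕ.+ k) 2)) ⟩
  (6 ℕ.+ k) ∸ 6     ≡⟨⟩
  k                 ∎)
  where
  open ℕ.≤-Reasoning
  s : ℕ
  s = (6 ℕ.+ k) / 2
  3≤s : 3 ℕ.≤ s
  3≤s = ℕ./-monoˡ-≤ 2 (ℕ.m≤m+n 6 k)

lagrangian-upper-bound : ∀ k (E : Edges (8 ℕ.+ k)) → Is3Graph E → LeftCompressed E → ¬ HasClique E ((6 ℕ.+ k) / 2) →
  (x : Fin (8 ℕ.+ k) → ℚ) → InSimplex x →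
  lagPoly E x * ℕ→ℚ (6 *ℕ (6 ℕ.+ k) *ℕ (7 ℕ.+ k)) ≤ ℕ→ℚ ((5 ℕ.+ k) ^ 2)
lagrangian-upper-bound k E isGraph compressed no-clique x x∈Δ =
  subst₂ (λ W R → lagPoly E x * W ≤ R) (sym (weight-ℚ k)) (sym (square-ℚ k)) by-size-of-a
  where
  a : ℕ
  a = (6 ℕ.+ k) / 2 ∸ 3
  3+a≡s : 3 ℕ.+ a ≡ (6 ℕ.+ k) / 2
  3+a≡s = proj₁ (clique-order-split k)
  2a≤k : 2 *ℕ a ℕ.≤ k
  2a≤k = proj₂ (clique-order-split k)
  edges-meet : ∀ i j l → toℕ i ℕ.< toℕ j → toℕ j ℕ.< toℕ l → E i j l ≡ true → toℕ i ℕ.< a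
  edges-meet = edges-meet-prefix isGraph compressed (subst (¬_ ∘ HasClique E) (sym 3+a≡s) no-clique)
    (ℕ.+-mono-≤ (ℕ.m≤m+n 3 5) (ℕ.≤-trans (ℕ.m≤n*m a 2) 2a≤k))
  by-size-of-a : lagPoly E x * (6 * (6 + ℕ→ℚ k) * (7 + ℕ→ℚ k)) ≤ (5 + ℕ→ℚ k) * (5 + ℕ→ℚ k)
  by-size-of-a with a ℕ.≤? 1
  ... | yes a≤1 = bound-from-vertex k E x x∈Δ (λ i j l i<j j<l e → ℕ.<-≤-trans (edges-meet i j l i<j j<l e) a≤1)
  ... | no  a≰1 = bound-from-prefix k (a ℕ.⊔ 4) E x x∈Δ (ℕ.m≤n⊔m a 4)
    (ℕ.≤-trans (ℕ.≤-reflexive (ℕ.*-distribˡ-⊔ 2 a 4))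
      (ℕ.⊔-lub (ℕ.≤-trans 2a≤k (ℕ.m≤n+m k 4)) (ℕ.+-monoʳ-≤ 4 (ℕ.≤-trans (ℕ.*-monoʳ-≤ 2 (ℕ.≰⇒> a≰1)) 2a≤k))))
    (λ i j l i<j j<l e → ℕ.<-≤-trans (edges-meet i j l i<j j<l e) (ℕ.m≤m⊔n a 4))

e₃-uniform : ∀ n c → ℕ→ℚ n * c ≡ 1ℚ → 6 * e₃ (tabulate {n = n} (λ _ → c)) ≡ 1ℚ - 3 * c + 2 * (c * c)
e₃-uniform n c nc≡1 = begin
  6 * e₃ ys
    ≡⟨ e₃-newton ys ⟩
  sumℚ ys * sumℚ ys * sumℚ ys - 3 * sumℚ ys * p₂ ys + 2 * p₃ ys
    ≡⟨ cong₃ (λ s P₂ P₃ → s * s * s - 3 * s * P₂ + 2 * P₃)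
         (trans (sumℚ-tabulate-const n c) nc≡1)
         (trans (sum-map (λ z → z * z)) (n*[c*q]≡q c))
         (trans (sum-map (λ z → z * z * z)) (trans (cong (ℕ→ℚ n *_) (ℚ.*-assoc c c c)) (n*[c*q]≡q (c * c)))) ⟩
  1ℚ * 1ℚ * 1ℚ - 3 * 1ℚ * c + 2 * (c * c)
    ≡⟨ simplify c ⟩
  1ℚ - 3 * c + 2 * (c * c) ∎
  where
  open ≡-Reasoning
  ys : List ℚ
  ys = tabulate {n = n} (λ _ → c)
  sum-map : ∀ f → sumℚ (map f ys) ≡ ℕ→ℚ n * f c
  sum-map f = trans (cong sumℚ (map-tabulate {n = n} (λ _ → c) f)) (sumℚ-tabulate-const n (f c))
  n*[c*q]≡q : ∀ q → ℕ→ℚ n * (c * q) ≡ q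
  n*[c*q]≡q q = trans (sym (ℚ.*-assoc (ℕ→ℚ n) c q)) (trans (cong (_* q) nc≡1) (ℚ.*-identityˡ q))
  simplify : ∀ c → 1ℚ * 1ℚ * 1ℚ - 3 * 1ℚ * c + 2 * (c * c) ≡ 1ℚ - 3 * c + 2 * (c * c)
  simplify = solve-∀ ℚ-ring

-- expand holds up to a multiple of (7 + κ)c − 1, which vanishes.
uniform-arith : ∀ {κ c e} → 0ℚ ≤ κ → (7 + κ) * c ≡ 1ℚ → 0ℚ < c → 6 * e ≡ 1ℚ - 3 * c + 2 * (c * c) →
  (5 + κ) * (5 + κ) < e * (6 * (6 + κ) * (7 + κ))
uniform-arith {κ} {c} {e} 0≤κ νc≡1 0<c 6e≡ = pos-gap⇒< ((5 + κ) * c)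
  (*-pos (ℚ.<-≤-trans (ℚ.positive⁻¹ 5) (nonNeg-gap⇒≤ κ 0≤κ refl)) 0<c) (begin
  e * (6 * (6 + κ) * (7 + κ))                  ≡⟨ regroup e κ ⟩
  6 * e * ((6 + κ) * (7 + κ))                  ≡⟨ cong (_* ((6 + κ) * (7 + κ))) 6e≡ ⟩
  (1ℚ - 3 * c + 2 * (c * c)) * ((6 + κ) * (7 + κ))
    ≡⟨ expand κ c ⟩
  (5 + κ) * (5 + κ) + ((5 + κ) * c + ((7 + κ) * c - 1ℚ) * (2 * c * (7 + κ) - 3 * (7 + κ) - 2 * c + 4))
    ≡⟨ cong (λ w → (5 + κ) * (5 + κ) + ((5 + κ) * c + (w - 1ℚ) * (2 * c * (7 + κ) - 3 * (7 + κ) - 2 * c + 4))) νc≡1 ⟩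
  (5 + κ) * (5 + κ) + ((5 + κ) * c + (1ℚ - 1ℚ) * (2 * c * (7 + κ) - 3 * (7 + κ) - 2 * c + 4))
    ≡⟨ vanish ((5 + κ) * (5 + κ)) ((5 + κ) * c) (2 * c * (7 + κ) - 3 * (7 + κ) - 2 * c + 4) ⟩
  (5 + κ) * (5 + κ) + (5 + κ) * c              ∎)
  where
  open ≡-Reasoning
  regroup : ∀ e κ → e * (6 * (6 + κ) * (7 + κ)) ≡ 6 * e * ((6 + κ) * (7 + κ))
  regroup = solve-∀ ℚ-ring
  expand : ∀ κ c → (1ℚ - 3 * c + 2 * (c * c)) * ((6 + κ) * (7 + κ))
    ≡ (5 + κ) * (5 + κ) + ((5 + κ) * c + ((7 + κ) * c - 1ℚ) * (2 * c * (7 + κ) - 3 * (7 + κ) - 2 * c + 4))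
  expand = solve-∀ ℚ-ring
  vanish : ∀ a b z → a + (b + (1ℚ - 1ℚ) * z) ≡ a + b
  vanish = solve-∀ ℚ-ring

uniform-point-beats : ∀ k → Σ (Fin (7 ℕ.+ k) → ℚ) λ y → InSimplex y ×
  (ℕ→ℚ ((5 ℕ.+ k) ^ 2) < lagPoly (Complete (7 ℕ.+ k)) y * ℕ→ℚ (6 *ℕ (6 ℕ.+ k) *ℕ (7 ℕ.+ k)))
uniform-point-beats k = y , ((λ _ → ℚ.<⇒≤ 0<c) , trans (cong sumℚ (map-tabulate id y)) Σy≡1) ,
  subst₂ _<_ (sym (square-ℚ k)) (cong₂ _*_ (sym (lagPoly-Complete (7 ℕ.+ k) y)) (sym (weight-ℚ k)))
    (uniform-arith {e = e₃ (tabulate y)} (ℕ→ℚ-nonNeg k) (trans (cong (_* c) (sym (ℕ→ℚ-+ 7 k))) νc≡1) 0<c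
      (e₃-uniform (7 ℕ.+ k) c νc≡1))
  where
  ν c : ℚ
  ν = ℕ→ℚ (7 ℕ.+ k)
  0<ν : 0ℚ < ν
  0<ν = ℚ.<-≤-trans (ℚ.positive⁻¹ 7) (ℕ→ℚ-mono-≤ (ℕ.m≤m+n 7 k))
  instance
    ν≢0 : ℚ.NonZero ν
    ν≢0 = ℚ.pos⇒nonZero ν {{positive 0<ν}}
  c = ℚ.1/ ν
  0<c : 0ℚ < c
  0<c = ℚ.positive⁻¹ c {{ℚ.1/pos⇒pos ν {{positive 0<ν}}}}
  νc≡1 : ν * c ≡ 1ℚ
  νc≡1 = ℚ.*-inverseʳ ν
  y : Fin (7 ℕ.+ k) → ℚ
  y _ = c
  Σy≡1 : sumℚ (tabulate y) ≡ 1ℚ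
  Σy≡1 = trans (sumℚ-tabulate-const (7 ℕ.+ k) c) νc≡1

LagrangianBounds : ℕ → Set
LagrangianBounds t = (E : Edges t) → Is3Graph E → LeftCompressed E →
  ¬ HasClique E ((t ∸ 2) / 2) →
  ((x : Fin t → ℚ) → InSimplex x →
    lagPoly E x * ℕ→ℚ (6 *ℕ (t ∸ 2) *ℕ (t ∸ 1)) ≤ ℕ→ℚ ((t ∸ 3) ^ 2))
  × Σ (Fin (t ∸ 1) → ℚ) (λ y → InSimplex y ×
    (ℕ→ℚ ((t ∸ 3) ^ 2) < lagPoly (Complete (t ∸ 1)) y * ℕ→ℚ (6 *ℕ (t ∸ 2) *ℕ (t ∸ 1))))

lagrangianBounds-from-8 : ∀ k → LagrangianBounds (8 ℕ.+ k)
lagrangianBounds-from-8 k E isGraph compressed no-clique =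
  lagrangian-upper-bound k E isGraph compressed no-clique , uniform-point-beats k

small-clique-order : ∀ t → t ℕ.< 8 → (t ∸ 2) / 2 ℕ.≤ 2 × (t ∸ 2) / 2 ℕ.≤ t
small-clique-order t t<8 =
  ℕ./-monoˡ-≤ 2 (ℕ.∸-monoˡ-≤ 2 (ℕ.s≤s⁻¹ t<8)) , ℕ.≤-trans (ℕ.m/n≤m (t ∸ 2) 2) (ℕ.m∸n≤m t 2)

theorem5 : (t : ℕ) (E : Edges t) → Is3Graph E → LeftCompressed E →
    ¬ HasClique E ((t ∸ 2) / 2) →
    ((x : Fin t → ℚ) → InSimplex x →
      lagPoly E x * ℕ→ℚ (6 *ℕ (t ∸ 2) *ℕ (t ∸ 1)) ≤ ℕ→ℚ ((t ∸ 3) ^ 2))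
    × Σ (Fin (t ∸ 1) → ℚ) (λ y → InSimplex y ×
      (ℕ→ℚ ((t ∸ 3) ^ 2) < lagPoly (Complete (t ∸ 1)) y * ℕ→ℚ (6 *ℕ (t ∸ 2) *ℕ (t ∸ 1))))
theorem5 t = case t ℕ.<? 8 of λ where
  (yes t<8) E _ _ no-clique →
    ⊥-elim (no-clique (small-clique E (proj₁ (small-clique-order t t<8)) (proj₂ (small-clique-order t t<8))))
  (no t≮8) →
    let (k , 8+k≡t) = ℕ.m≤n⇒∃[o]m+o≡n (ℕ.≮⇒≥ t≮8) in subst LagrangianBounds 8+k≡t (lagrangianBounds-from-8 k)
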